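{- Suppose $d,k,n$ are positive integers with $k\ge 2$ and $n\ge 3$. Let \[\delta=\min\left(d,\left\lfloor\frac n2\right\rfloor\right)\quad\text{and}\quad m=\left\lfloor\frac{(k-1)n}{\delta+1}\right\rfloor .\] Then \[\chi^k_d(C_n)=\begin{cases}1&\text{if }1\le d\le k-2,\\[0.3em] \left\lceil\dfrac nm\right\rceil&\text{if }d\ge k-1.\end{cases}\]
   Context: $C_n$ is the cycle graph on $n$ vertices. A shortest path in a graph $G$ is a path between some vertices $u,v$ whose length (number of edges) equals the graph distance between $u$ and $v$. A set $S\subseteq V(G)$ is $k,d$-independent in $G$ if every shortest path in $G$ of length at most $d$ contains fewer than $k$ vertices of $S$. A coloring $f:V(G)\to\{1,\dots,c\}$ is a $k,d$-proper $c$-coloring if every color class is $k,d$-independent. The $k,d$-chromatic number $\chi^k_d(G)$ is the least positive integer $c$ for which $G$ admits a $k,d$-proper $c$-coloring. -}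

module Defs where

open import Data.Fin using (Fin; toℕ; _≟_)
open import Data.Fin.Subset using (Subset)
open import Data.Fin.Subset.Properties using (_∈?_)
open import Data.List using (List; []; _∷_; filter) renaming (length to ∣_∣)
open import Data.List.Relation.Unary.Unique.Propositional using (Unique)
open import Data.Nat using (ℕ; suc; _+_; _*_; _∸_; _⊓_; _≤_; _<_; z≤n; s≤s; NonZero; >-nonZero)
open import Data.Nat.DivMod using (_/_; m/n<m; m≥n⇒m/n>0)
open import Data.Nat.Properties using (≤-trans; m⊓n≤n; 1+n≢n; m≤n*m)
open import Data.Product using (Σ; ∃; _×_; _,_)
open import Data.Sum using (_⊎_; inj₁; inj₂; swap)
open import Data.Vec using (tabulate)
open import Relation.Binary.PropositionalEquality using (_≡_; refl; sym; trans; cong)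
open import Relation.Nullary using (¬_; does)

record Graph (n : ℕ) : Set₁ where
  field
    Adj       : Fin n → Fin n → Set
    symmetric : ∀ {u v} → Adj u v → Adj v u
    loopless  : ∀ {v} → ¬ Adj v v

-- The cyclic successor relation u ↦ u + 1 mod n on Fin n.
Next : ∀ {n} → Fin n → Fin n → Set
Next {n} u v = suc (toℕ u) ≡ toℕ v ⊎ (suc (toℕ u) ≡ n × toℕ v ≡ 0)

private
  Next-irrefl : ∀ {n} → 3 ≤ n → {v : Fin n} → ¬ Next v v
  Next-irrefl _   (inj₁ e)        = 1+n≢n e
  Next-irrefl n≥3 (inj₂ (e , v≡0)) with trans (sym e) (cong suc v≡0)
  Next-irrefl (s≤s ()) (inj₂ _) | refl

cycle : ∀ n → 3 ≤ n → Graph n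
cycle n n≥3 = record
  { Adj       = λ u v → Next u v ⊎ Next v u
  ; symmetric = swap
  ; loopless  = λ { (inj₁ e) → Next-irrefl n≥3 e ; (inj₂ e) → Next-irrefl n≥3 e }
  }

module _ {n : ℕ} (G : Graph n) where
  open Graph G

  data Walk : Fin n → Fin n → Set where
    stop : ∀ {v} → Walk v v
    step : ∀ {u v w} → Adj u v → Walk v w → Walk u w

  walkVertices : ∀ {u v} → Walk u v → List (Fin n)
  walkVertices {u} stop       = u ∷ []
  walkVertices {u} (step _ p) = u ∷ walkVertices p

  walkLength : ∀ {u v} → Walk u v → ℕ
  walkLength stop       = 0
  walkLength (step _ p) = suc (walkLength p)

  record Path (u v : Fin n) : Set where
    field
      walk   : Walk u v
      simple : Unique (walkVertices walk)

    vertices : List (Fin n)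
    vertices = walkVertices walk

    length : ℕ
    length = walkLength walk

  -- A relation rather than a function: the distance is undefined between
  -- vertices in different components.
  IsDistance : Fin n → Fin n → ℕ → Set
  IsDistance u v ℓ =
    (Σ (Path u v) λ p → Path.length p ≡ ℓ) × (∀ (p : Path u v) → ℓ ≤ Path.length p)

  IsShortest : ∀ {u v} → Path u v → Set
  IsShortest {u} {v} p = IsDistance u v (Path.length p)

  -- Vertices on a path are distinct, so the filtered list counts each
  -- vertex of S on the path once.
  Independent : (k d : ℕ) → Subset n → Set
  Independent k d S = ∀ {u v} (p : Path u v) → IsShortest p → Path.length p ≤ d →
    ∣ filter (_∈? S) (Path.vertices p) ∣ < k

  colorClass : ∀ {c} → (Fin n → Fin c) → Fin c → Subset n
  colorClass f i = tabulate (λ v → does (f v ≟ i))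

  Proper : (k d : ℕ) {c : ℕ} → (Fin n → Fin c) → Set
  Proper k d f = ∀ i → Independent k d (colorClass f i)

  Colorable : (k d c : ℕ) → Set
  Colorable k d c = ∃ λ (f : Fin n → Fin c) → Proper k d f

  -- "χ^k_d(G) = c".  A relation rather than a function: for k ≤ 1 and
  -- n ≥ 1 no proper coloring exists.
  IsChromaticNumber : (k d c : ℕ) → Set
  IsChromaticNumber k d c =
    1 ≤ c × Colorable k d c × (∀ c′ → 1 ≤ c′ → Colorable k d c′ → c ≤ c′)

⌈_/_⌉ : (a b : ℕ) .{{_ : NonZero b}} → ℕ
⌈ a / b ⌉ = (a + (b ∸ 1)) / b

-- Makes the division by m = ⌊(k-1)n/(δ+1)⌋ well defined.
m-nonZero : ∀ d k n → 2 ≤ k → 3 ≤ n → NonZero (((k ∸ 1) * n) / suc (d ⊓ (n / 2)))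
m-nonZero d (suc (suc k)) n@(suc _) (s≤s (s≤s _)) n≥3 =
  >-nonZero (m≥n⇒m/n>0 (≤-trans (s≤s (m⊓n≤n d (n / 2)))
    (≤-trans (m/n<m n 2 (s≤s (s≤s z≤n))) (m≤n*m n (suc k)))))

{-# OPTIONS --safe #-}

-- On a cycle, the simple walks are the arcs traversed in one direction, and the
-- shortest paths are the arcs with at most ⌊n/2⌋ edges.  So a set S is
-- k,d-independent iff every window of W = δ + 1 consecutive vertices meets S in
-- at most k − 1 points.
--
-- Lower bound: averaging over the n windows gives |S| W ≤ (k − 1) n, that is
-- |S| ≤ m, so c color classes cover at most c m vertices.
--
-- Upper bound: rotate the residues by m, coloring v with ⌊((v + 1) m mod n) / m⌋.
-- A color class consists of the times at which the rotation enters an interval of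
-- length at most m, which happens at most once per lap.  Laps are counted by
-- t ↦ ⌊(t m + const) / n⌋, and this grows by at most k − 1 over a window since
-- W m ≤ (k − 1) n.
module Submission where

open import Defs
import Algebra.Properties.CommutativeMonoid.Sum as Sum
open import Data.Bool using (true; false; if_then_else_)
open import Data.Fin using (Fin; zero; suc; toℕ; fromℕ<; _≟_)
open import Data.Fin.Properties using (toℕ-injective; toℕ-fromℕ<; toℕ<n)
open import Data.Fin.Subset using (Subset; _∈_)
open import Data.Fin.Subset.Properties using (_∈?_)
open import Data.List using (List; []; _∷_; filter; length; applyUpTo; applyDownFrom)
open import Data.List.Properties using (length-filter)
import Data.List.Membership.Propositional as List
import Data.List.Relation.Unary.All as All
open import Data.List.Relation.Unary.Any using (here; there)
open import Data.List.Relation.Unary.AllPairs using (_∷_)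
open import Data.List.Relation.Unary.Unique.Propositional using (Unique)
open import Data.List.Relation.Unary.Unique.Propositional.Properties
  using (applyUpTo⁺₁; applyDownFrom⁺₁)
open import Data.Nat
  using (ℕ; zero; suc; _+_; _*_; _∸_; _⊓_; _≤_; _<_; z≤n; s≤s; s≤s⁻¹;
    NonZero; >-nonZero; >-nonZero⁻¹)
open import Data.Nat.DivMod
open import Data.Nat.Divisibility using (n∣m*n)
open import Data.Nat.Properties hiding (_≟_)
open import Data.Nat.Solver using (module +-*-Solver)
open import Data.Product using (_×_; _,_; proj₁; proj₂)
open import Data.Sum using (_⊎_; inj₁; inj₂)
open import Data.Vec.Properties using (lookup⇒[]=; []=⇒lookup; lookup∘tabulate)
open import Function using (_∘_)
open import Relation.Binary.PropositionalEquality
open import Relation.Nullary using (yes; no; does; contradiction)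
open import Relation.Nullary.Decidable using (dec-true)

open Sum +-0-commutativeMonoid using (sum; ∑-comm; sum-cong-≗)

-- Finite sums and counting

sum-upper : ∀ {n c} (t : Fin n → ℕ) → (∀ i → t i ≤ c) → sum t ≤ n * c
sum-upper {zero}  t t≤c = z≤n
sum-upper {suc n} t t≤c = +-mono-≤ (t≤c zero) (sum-upper (t ∘ suc) (t≤c ∘ suc))

sum-lower : ∀ {n c} (t : Fin n → ℕ) → (∀ i → c ≤ t i) → n * c ≤ sum t
sum-lower {zero}  t c≤t = z≤n
sum-lower {suc n} t c≤t = +-mono-≤ (c≤t zero) (sum-lower (t ∘ suc) (c≤t ∘ suc))

term≤sum : ∀ {n} (t : Fin n → ℕ) i → t i ≤ sum t
term≤sum t zero    = m≤m+n _ _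
term≤sum t (suc i) = ≤-trans (term≤sum (t ∘ suc) i) (m≤n+m _ _)

-- Both sides are the sum of `h` over 0 to `n`, with the first or the last term split off.
sum-shift : ∀ n (h : ℕ → ℕ) →
  h 0 + sum {n} (λ i → h (suc (toℕ i))) ≡ sum {n} (λ i → h (toℕ i)) + h n
sum-shift zero    h = +-identityʳ (h 0)
sum-shift (suc n) h =
  trans (cong (h 0 +_) (sum-shift n (h ∘ suc))) (sym (+-assoc (h 0) _ _))

-- Advancing the start from `s` to `suc s` drops the term `h s` and gains `h (s + n)`, which
-- periodicity makes equal.
sum-periodic : ∀ n (h : ℕ → ℕ) → (∀ t → h (n + t) ≡ h t) →
  ∀ s → sum {n} (λ i → h (s + toℕ i)) ≡ sum {n} (λ i → h (toℕ i))
sum-periodic n h per zero    = refl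
sum-periodic n h per (suc s) = trans (+-cancelˡ-≡ (h s) _ _ (begin
  h s + sum {n} (λ i → h (suc (s + toℕ i)))   ≡⟨ sum-shift′ ⟩
  sum {n} (λ i → h (s + toℕ i)) + h (s + n)   ≡⟨ cong (sum {n} (λ i → h (s + toℕ i)) +_)
                                                   (trans (cong h (+-comm s n)) (per s)) ⟩
  sum {n} (λ i → h (s + toℕ i)) + h s         ≡⟨ +-comm _ (h s) ⟩
  h s + sum {n} (λ i → h (s + toℕ i))         ∎))
  (sum-periodic n h per s)
  where
  open ≡-Reasoning
  sum-shift′ : h s + sum {n} (λ i → h (suc (s + toℕ i))) ≡ sum {n} (λ i → h (s + toℕ i)) + h (s + n)
  sum-shift′ = trans
    (cong₂ _+_ (cong h (sym (+-identityʳ s)))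
      (sum-cong-≗ {n} (λ i → cong h (sym (+-suc s (toℕ i))))))
    (sum-shift n (λ t → h (s + t)))

χ : ∀ {n} → Subset n → Fin n → ℕ
χ S v = if does (v ∈? S) then 1 else 0

χ-∈ : ∀ {n} {S : Subset n} {v} → v ∈ S → χ S v ≡ 1
χ-∈ {S = S} {v} v∈S = cong (if_then 1 else 0) (dec-true (v ∈? S) v∈S)

count : ∀ {n} → Subset n → List (Fin n) → ℕ
count S xs = length (filter (_∈? S) xs)

count-∷ : ∀ {n} (S : Subset n) x xs → count S (x ∷ xs) ≡ χ S x + count S xs
count-∷ S x xs with does (x ∈? S)
... | true  = refl
... | false = refl

count-applyUpTo : ∀ {n} (S : Subset n) f ℓ →
  count S (applyUpTo f ℓ) ≡ sum {ℓ} (λ i → χ S (f (toℕ i)))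
count-applyUpTo S f zero    = refl
count-applyUpTo S f (suc ℓ) =
  trans (count-∷ S (f 0) _) (cong (χ S (f 0) +_) (count-applyUpTo S (f ∘ suc) ℓ))

module _ {n} (S : Subset n) where

  -- `H` acts as a potential that rises by at least one at every visit to `S`, so its total rise
  -- bounds the number of visits. The companion below treats the same vertices listed in reverse, as
  -- a backward walk meets them.
  count-telescope-up : ∀ f (H : ℕ → ℕ) → (∀ i → H i + χ S (f i) ≤ H (suc i)) →
    ∀ ℓ → H 0 + count S (applyUpTo f ℓ) ≤ H ℓ
  count-telescope-up f H H-step zero    = ≤-reflexive (+-identityʳ (H 0))
  count-telescope-up f H H-step (suc ℓ) = begin
    H 0 + count S (applyUpTo f (suc ℓ))                    ≡⟨ cong (H 0 +_) (count-∷ S (f 0) _) ⟩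
    H 0 + (χ S (f 0) + count S (applyUpTo (f ∘ suc) ℓ))    ≡⟨ +-assoc (H 0) _ _ ⟨
    H 0 + χ S (f 0) + count S (applyUpTo (f ∘ suc) ℓ)      ≤⟨ +-monoˡ-≤ _ (H-step 0) ⟩
    H 1 + count S (applyUpTo (f ∘ suc) ℓ)                  ≤⟨ count-telescope-up (f ∘ suc) (H ∘ suc) (H-step ∘ suc) ℓ ⟩
    H (suc ℓ)                                              ∎
    where open ≤-Reasoning

  count-telescope-down : ∀ f (H : ℕ → ℕ) → (∀ i → H i + χ S (f i) ≤ H (suc i)) →
    ∀ ℓ → H 0 + count S (applyDownFrom f ℓ) ≤ H ℓ
  count-telescope-down f H H-step zero    = ≤-reflexive (+-identityʳ (H 0))
  count-telescope-down f H H-step (suc ℓ) = begin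
    H 0 + count S (applyDownFrom f (suc ℓ))            ≡⟨ cong (H 0 +_) (trans (count-∷ S (f ℓ) _) (+-comm (χ S (f ℓ)) _)) ⟩
    H 0 + (count S (applyDownFrom f ℓ) + χ S (f ℓ))    ≡⟨ +-assoc (H 0) _ _ ⟨
    H 0 + count S (applyDownFrom f ℓ) + χ S (f ℓ)      ≤⟨ +-monoˡ-≤ _ (count-telescope-down f H H-step ℓ) ⟩
    H ℓ + χ S (f ℓ)                                    ≤⟨ H-step ℓ ⟩
    H (suc ℓ)                                          ∎
    where open ≤-Reasoning

module _ {n c} {G : Graph n} (f : Fin n → Fin c) where

  ∈-colorClass⁺ : ∀ v → v ∈ colorClass G f (f v)
  ∈-colorClass⁺ v = lookup⇒[]= v _
    (trans (lookup∘tabulate _ v) (dec-true (f v ≟ f v) refl))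

  ∈-colorClass⁻ : ∀ {v i} → v ∈ colorClass G f i → f v ≡ i
  ∈-colorClass⁻ {v} {i} v∈ with trans (sym (lookup∘tabulate _ v)) ([]=⇒lookup v∈)
  ... | does≡true with f v ≟ i
  ... | yes fv≡i = fv≡i
  ∈-colorClass⁻ _ | () | no _

-- Division

m*n≤o⇒m≤o/n : ∀ m n {o} .{{_ : NonZero n}} → m * n ≤ o → m ≤ o / n
m*n≤o⇒m≤o/n m n m*n≤o = subst (_≤ _) (m*n/n≡m m n) (/-monoˡ-≤ n m*n≤o)

[m*n+o]/n≡m+o/n : ∀ m n o .{{_ : NonZero n}} → (m * n + o) / n ≡ m + o / n
[m*n+o]/n≡m+o/n m n o =
  trans (+-distrib-/-∣ˡ o (n∣m*n m)) (cong (_+ o / n) (m*n/n≡m m n))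

m≤o*n⇒⌈m/n⌉≤o : ∀ m n o .{{_ : NonZero n}} → m ≤ o * n → ⌈ m / n ⌉ ≤ o
m≤o*n⇒⌈m/n⌉≤o m n@(suc n-1) o m≤o*n = s≤s⁻¹ (m<n*o⇒m/o<n {n = suc o} (begin-strict
  m + n-1      ≡⟨ +-comm m n-1 ⟩
  n-1 + m      <⟨ +-mono-<-≤ (n<1+n n-1) m≤o*n ⟩
  n + o * n    ∎))
  where open ≤-Reasoning

r<m⇒r/n<⌈m/n⌉ : ∀ {r} m n .{{_ : NonZero n}} → r < m → r / n < ⌈ m / n ⌉
r<m⇒r/n<⌈m/n⌉ {r} m n@(suc n-1) r<m = m*n≤o⇒m≤o/n (suc (r / n)) n (begin
  n + r / n * n    ≤⟨ +-monoʳ-≤ n (m/n*n≤m r n) ⟩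
  suc (n-1 + r)    ≡⟨ +-suc n-1 r ⟨
  n-1 + suc r      ≤⟨ +-monoʳ-≤ n-1 r<m ⟩
  n-1 + m          ≡⟨ +-comm n-1 m ⟩
  m + n-1          ∎)
  where open ≤-Reasoning

n+n≤m⇒n≤m/2 : ∀ {m n} → n + n ≤ m → n ≤ m / 2
n+n≤m⇒n≤m/2 {m} {n} n+n≤m = m*n≤o⇒m≤o/n n 2
  (subst (_≤ m) (trans (cong (n +_) (sym (+-identityʳ n))) (*-comm 2 n)) n+n≤m)

n≤m/2⇒n+n≤m : ∀ {m n} → n ≤ m / 2 → n + n ≤ m
n≤m/2⇒n+n≤m {m} {n} n≤m/2 = begin
  n + n        ≡⟨ cong (n +_) (+-identityʳ n) ⟨
  2 * n        ≡⟨ *-comm 2 n ⟩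
  n * 2        ≤⟨ *-monoˡ-≤ 2 n≤m/2 ⟩
  m / 2 * 2    ≤⟨ m/n*n≤m m 2 ⟩
  m            ∎
  where open ≤-Reasoning

-- Residues

module _ {n} .{{_ : NonZero n}} where

  toℕ-mod : ∀ t → toℕ (t mod n) ≡ t % n
  toℕ-mod t = toℕ-fromℕ< (m%n<n t n)

  mod-cong : ∀ s t → s % n ≡ t % n → s mod n ≡ t mod n
  mod-cong s t eq = toℕ-injective (trans (toℕ-mod s) (trans eq (sym (toℕ-mod t))))

  mod-% : ∀ s t → s mod n ≡ t mod n → s % n ≡ t % n
  mod-% s t eq = trans (sym (toℕ-mod s)) (trans (cong toℕ eq) (toℕ-mod t))

  toℕ-mod-id : ∀ v → toℕ v mod n ≡ v
  toℕ-mod-id v = toℕ-injective (trans (toℕ-mod (toℕ v)) (m<n⇒m%n≡m (toℕ<n v)))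

  [n+t]mod : ∀ t → (n + t) mod n ≡ t mod n
  [n+t]mod t = mod-cong (n + t) t (trans (cong (_% n) (+-comm n t)) ([m+n]%n≡m%n t n))

  %-+-cong : ∀ i j s → i % n ≡ j % n → (i + s) % n ≡ (j + s) % n
  %-+-cong i j s eq = trans (%-distribˡ-+ i s n)
    (trans (cong (λ r → (r + s % n) % n) eq) (sym (%-distribˡ-+ j s n)))

  mod-toℕ-+ : ∀ i t → (i + toℕ (t mod n)) mod n ≡ (i + t) mod n
  mod-toℕ-+ i t = mod-cong (i + toℕ (t mod n)) (i + t) (begin
    (i + toℕ (t mod n)) % n    ≡⟨ cong (λ r → (i + r) % n) (toℕ-mod t) ⟩
    (i + t % n) % n            ≡⟨ cong (_% n) (+-comm i (t % n)) ⟩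
    (t % n + i) % n            ≡⟨ %-+-cong (t % n) t i (m%n%n≡m%n t n) ⟩
    (t + i) % n                ≡⟨ cong (_% n) (+-comm t i) ⟩
    (i + t) % n                ∎)
    where open ≡-Reasoning

  %-+-cancel : ∀ i j s → (i + s) % n ≡ (j + s) % n → i % n ≡ j % n
  %-+-cancel i j s eq = begin
    i % n                        ≡⟨ expand i ⟩
    (i + s + (s * n ∸ s)) % n    ≡⟨ %-+-cong (i + s) (j + s) (s * n ∸ s) eq ⟩
    (j + s + (s * n ∸ s)) % n    ≡⟨ expand j ⟨
    j % n                        ∎
    where
    open ≡-Reasoning
    -- `s * n ∸ s` is a natural number representing the additive inverse of `s` modulo `n`.
    expand : ∀ x → x % n ≡ (x + s + (s * n ∸ s)) % n
    expand x = trans (sym ([m+kn]%n≡m%n x s n)) (cong (_% n)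
      (trans (cong (x +_) (sym (m+[n∸m]≡n (m≤m*n s n)))) (sym (+-assoc x s _))))

  -- The vertex reached after `i` forward steps from the residue of `s`. The offset `s` is an
  -- arbitrary natural number, so shifted starting points need no reduction.
  lap : ℕ → ℕ → Fin n
  lap s i = (i + s) mod n

  lap-injective : ∀ s {i j} → i < n → j < n → lap s i ≡ lap s j → i ≡ j
  lap-injective s {i} {j} i<n j<n eq = trans (sym (m<n⇒m%n≡m i<n))
    (trans (%-+-cancel i j s (mod-% (i + s) (j + s) eq)) (m<n⇒m%n≡m j<n))

  Next-mod : ∀ {u v : Fin n} → Next u v → v ≡ suc (toℕ u) mod n
  Next-mod {u} {v} (inj₁ e) = trans (sym (toℕ-mod-id v)) (cong (_mod n) (sym e))
  Next-mod {u} {v} (inj₂ (e , v≡0)) = toℕ-injective (trans v≡0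
    (sym (trans (toℕ-mod (suc (toℕ u))) (trans (cong (_% n) e) (n%n≡0 n)))))

  mod-Next : ∀ (u : Fin n) → Next u (suc (toℕ u) mod n)
  mod-Next u with m≤n⇒m<n∨m≡n (toℕ<n u)
  ... | inj₁ lt = inj₁ (sym (trans (toℕ-mod (suc (toℕ u))) (m<n⇒m%n≡m lt)))
  ... | inj₂ eq = inj₂ (eq , trans (toℕ-mod (suc (toℕ u))) (trans (cong (_% n) eq) (n%n≡0 n)))

  lap-Next : ∀ s i → Next (lap s i) (lap s (suc i))
  lap-Next s i = subst (Next (lap s i)) (mod-toℕ-+ 1 (i + s)) (mod-Next (lap s i))

  Next-functional : ∀ {u v w : Fin n} → Next u v → Next u w → v ≡ w
  Next-functional e e′ = trans (Next-mod e) (sym (Next-mod e′))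

Next-injective : ∀ {n} {u v w : Fin n} → Next u w → Next v w → u ≡ v
Next-injective (inj₁ e)       (inj₁ e′)       = toℕ-injective (suc-injective (trans e (sym e′)))
Next-injective (inj₂ (e , _)) (inj₂ (e′ , _)) = toℕ-injective (suc-injective (trans e (sym e′)))
Next-injective (inj₁ e)       (inj₂ (_ , w0)) = contradiction (trans e w0) λ ()
Next-injective (inj₂ (_ , w0)) (inj₁ e)       = contradiction (trans e w0) λ ()

-- Shortest paths of the cycle

module _ {n} (n≥3 : 3 ≤ n) where

  private
    C = cycle n n≥3
    instance
      n-nonZero : NonZero n
      n-nonZero = >-nonZero (≤-trans (s≤s z≤n) n≥3)

  -- Forward walks recurse on the tail `f ∘ suc`. The tail of `lap s` agrees with `lap (suc s)` only
  -- up to a propositional equality, so the walk lemmas are stated for arbitrary orbits.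
  Orbit : (ℕ → Fin n) → Set
  Orbit f = ∀ i → Next (f i) (f (suc i))

  lap-orbit : ∀ s → Orbit (lap s)
  lap-orbit = lap-Next {n}

  data Forward : ∀ {u v} → Walk C u v → Set where
    stop : ∀ {v} → Forward (stop {v = v})
    step : ∀ {u v w} (e : Next u v) {p : Walk C v w} → Forward p → Forward (step (inj₁ e) p)

  data Backward : ∀ {u v} → Walk C u v → Set where
    stop : ∀ {v} → Backward (stop {v = v})
    step : ∀ {u v w} (e : Next v u) {p : Walk C v w} → Backward p → Backward (step (inj₂ e) p)

  start∈vertices : ∀ {u v} (p : Walk C u v) → u List.∈ walkVertices C p
  start∈vertices stop       = here refl
  start∈vertices (step _ _) = here refl

  -- Each vertex has one successor and one predecessor, so a change of direction returns at once to
  -- the vertex two places earlier, which simplicity forbids.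
  monotone : ∀ {u v} (p : Walk C u v) → Unique (walkVertices C p) → Forward p ⊎ Backward p
  monotone stop _ = inj₁ stop
  monotone (step (inj₁ e) stop) _ = inj₁ (step e stop)
  monotone (step (inj₂ e) stop) _ = inj₂ (step e stop)
  monotone (step (inj₁ e) p@(step (inj₁ _) _)) (_ ∷ p!) with monotone p p!
  ... | inj₁ fwd = inj₁ (step e fwd)
  monotone (step (inj₂ e) p@(step (inj₂ _) _)) (_ ∷ p!) with monotone p p!
  ... | inj₂ bwd = inj₂ (step e bwd)
  monotone (step (inj₁ e) (step (inj₂ e′) q)) (u∉ ∷ _) =
    contradiction (Next-injective e e′) (All.lookup u∉ (there (start∈vertices q)))
  monotone (step (inj₂ e) (step (inj₁ e′) q)) (u∉ ∷ _) =
    contradiction (Next-functional e e′) (All.lookup u∉ (there (start∈vertices q)))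

  module _ (f : ℕ → Fin n) (f-Next : Orbit f) where

    -- The orbit is anchored at the final vertex: a backward walk is then `f` read from index
    -- `walkLength C p` down to 0, and `f` stays fixed in the recursion.
    backward-vertices : ∀ {u v} {p : Walk C u v} → Backward p → f 0 ≡ v →
      f (walkLength C p) ≡ u × walkVertices C p ≡ applyDownFrom f (suc (walkLength C p))
    backward-vertices stop refl = refl , refl
    backward-vertices (step e {p} bwd) eq
      with eq′ , eqs ← backward-vertices bwd eq
      with eq″ ← Next-functional (subst (λ x → Next x (f (suc (walkLength C p)))) eq′ (f-Next (walkLength C p))) e
      = eq″ , cong₂ _∷_ (sym eq″) eqs

    backwardWalk : ∀ ℓ → Walk C (f ℓ) (f 0)
    backwardWalk zero    = stop
    backwardWalk (suc ℓ) = step (inj₂ (f-Next ℓ)) (backwardWalk ℓ)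

    backwardWalk-length : ∀ ℓ → walkLength C (backwardWalk ℓ) ≡ ℓ
    backwardWalk-length zero    = refl
    backwardWalk-length (suc ℓ) = cong suc (backwardWalk-length ℓ)

    backwardWalk-vertices : ∀ ℓ → walkVertices C (backwardWalk ℓ) ≡ applyDownFrom f (suc ℓ)
    backwardWalk-vertices zero    = refl
    backwardWalk-vertices (suc ℓ) = cong (f (suc ℓ) ∷_) (backwardWalk-vertices ℓ)

  forward-vertices : ∀ f → Orbit f →
    ∀ {u v} {p : Walk C u v} → Forward p → f 0 ≡ u →
    f (walkLength C p) ≡ v × walkVertices C p ≡ applyUpTo f (suc (walkLength C p))
  forward-vertices f f-Next stop refl = refl , refl
  forward-vertices f f-Next (step e fwd) refl
    with forward-vertices (f ∘ suc) (f-Next ∘ suc) fwd (Next-functional (f-Next 0) e)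
  ... | eq , eqs = eq , cong (f 0 ∷_) eqs

  forwardWalk : ∀ f → Orbit f → ∀ ℓ → Walk C (f 0) (f ℓ)
  forwardWalk f f-Next zero    = stop
  forwardWalk f f-Next (suc ℓ) = step (inj₁ (f-Next 0)) (forwardWalk (f ∘ suc) (f-Next ∘ suc) ℓ)

  forwardWalk-length : ∀ f (f-Next : Orbit f) ℓ → walkLength C (forwardWalk f f-Next ℓ) ≡ ℓ
  forwardWalk-length f f-Next zero    = refl
  forwardWalk-length f f-Next (suc ℓ) = cong suc (forwardWalk-length (f ∘ suc) (f-Next ∘ suc) ℓ)

  forwardWalk-vertices : ∀ f (f-Next : Orbit f) ℓ →
    walkVertices C (forwardWalk f f-Next ℓ) ≡ applyUpTo f (suc ℓ)
  forwardWalk-vertices f f-Next zero    = refl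
  forwardWalk-vertices f f-Next (suc ℓ) =
    cong (f 0 ∷_) (forwardWalk-vertices (f ∘ suc) (f-Next ∘ suc) ℓ)

  forwardPath : ∀ s {ℓ} → ℓ < n → Path C (lap s 0) (lap s ℓ)
  forwardPath s {ℓ} ℓ<n = record
    { walk   = forwardWalk (lap s) (lap-orbit s) ℓ
    ; simple = subst Unique (sym (forwardWalk-vertices (lap s) (lap-orbit s) ℓ))
        (applyUpTo⁺₁ (lap s) (suc ℓ) λ i<j j<1+ℓ eq →
          <⇒≢ i<j (lap-injective s (<-trans i<j (≤-trans j<1+ℓ ℓ<n)) (≤-trans j<1+ℓ ℓ<n) eq))
    }

  backwardPath : ∀ s {ℓ} → ℓ < n → Path C (lap s ℓ) (lap s 0)
  backwardPath s {ℓ} ℓ<n = record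
    { walk   = backwardWalk (lap s) (lap-orbit s) ℓ
    ; simple = subst Unique (sym (backwardWalk-vertices (lap s) (lap-orbit s) ℓ))
        (applyDownFrom⁺₁ (lap s) (suc ℓ) λ j<i i<1+ℓ eq →
          <⇒≢ j<i (sym (lap-injective s (≤-trans i<1+ℓ ℓ<n) (<-trans j<i (≤-trans i<1+ℓ ℓ<n)) eq)))
    }

  Minimal : (u v : Fin n) → ℕ → Set
  Minimal u v ℓ = ∀ (p : Path C u v) → ℓ ≤ Path.length p

  -- The explicit forward arc with `r` edges is a competing path; `r < n` makes it simple.
  minimal≤forward : ∀ {u v ℓ r} → Minimal u v ℓ → r < n → lap (toℕ u) r ≡ v → ℓ ≤ r
  minimal≤forward {u} {v} {ℓ} {r} minimal r<n eq = ≤-trans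
    (subst₂ (λ a b → Minimal a b ℓ) (sym (toℕ-mod-id u)) (sym eq) minimal (forwardPath (toℕ u) r<n))
    (≤-reflexive (forwardWalk-length (lap (toℕ u)) (lap-orbit (toℕ u)) r))

  minimal≤backward : ∀ {u v ℓ r} → Minimal u v ℓ → r < n → lap (toℕ v) r ≡ u → ℓ ≤ r
  minimal≤backward {u} {v} {ℓ} {r} minimal r<n eq = ≤-trans
    (subst₂ (λ a b → Minimal a b ℓ) (sym eq) (sym (toℕ-mod-id v)) minimal (backwardPath (toℕ v) r<n))
    (≤-reflexive (backwardWalk-length (lap (toℕ v)) (lap-orbit (toℕ v)) r))

  -- Compares an arc with its reduction mod n and with the complementary arc.
  arc-bound : ∀ {u v : Fin n} {ℓ} → lap (toℕ u) ℓ ≡ v →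
    (∀ {r} → r < n → lap (toℕ u) r ≡ v → ℓ ≤ r) →
    (∀ {r} → r < n → lap (toℕ v) r ≡ u → ℓ ≤ r) →
    ℓ ≤ n / 2
  arc-bound {ℓ = zero} _ _ _ = z≤n
  arc-bound {u} {v} {ℓ@(suc ℓ-1)} eq same complementary =
    n+n≤m⇒n≤m/2 (≤-trans (+-monoˡ-≤ ℓ ℓ≤n∸ℓ) (≤-reflexive (m∸n+n≡m (<⇒≤ ℓ<n))))
    where
    s = toℕ u

    ℓ<n : ℓ < n
    ℓ<n = ≤-<-trans (same (m%n<n ℓ n)
      (trans (mod-cong (ℓ % n + s) (ℓ + s) (%-+-cong (ℓ % n) ℓ s (m%n%n≡m%n ℓ n))) eq)) (m%n<n ℓ n)

    closes : lap (toℕ v) (n ∸ ℓ) ≡ u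
    closes = begin
      (n ∸ ℓ + toℕ v) mod n                ≡⟨ cong (λ x → (n ∸ ℓ + toℕ x) mod n) eq ⟨
      (n ∸ ℓ + toℕ ((ℓ + s) mod n)) mod n  ≡⟨ mod-toℕ-+ (n ∸ ℓ) (ℓ + s) ⟩
      (n ∸ ℓ + (ℓ + s)) mod n              ≡⟨ cong (_mod n) (+-assoc (n ∸ ℓ) ℓ s) ⟨
      (n ∸ ℓ + ℓ + s) mod n                ≡⟨ cong (λ x → (x + s) mod n) (m∸n+n≡m (<⇒≤ ℓ<n)) ⟩
      (n + s) mod n                        ≡⟨ [n+t]mod s ⟩
      s mod n                              ≡⟨ toℕ-mod-id u ⟩
      u                                    ∎
      where open ≡-Reasoning

    -- The complementary arc has fewer than `n` edges because `ℓ` is positive; the zero case is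
    -- split off for this.
    ℓ≤n∸ℓ : ℓ ≤ n ∸ ℓ
    ℓ≤n∸ℓ = complementary (∸-monoʳ-< (s≤s z≤n) (<⇒≤ ℓ<n)) closes

  module _ {u v} (p : Path C u v) where

    open Path p using (walk) renaming (length to len)

    forward-shortest : Forward walk → IsShortest C p → len ≤ n / 2
    forward-shortest fwd (_ , minimal) =
      arc-bound (proj₁ (forward-vertices (lap (toℕ u)) (lap-orbit (toℕ u)) fwd (toℕ-mod-id u)))
        (minimal≤forward minimal) (minimal≤backward minimal)

    -- Read from its end `v`, the path is a forward arc to `u`, so the two minimality arguments
    -- trade places.
    backward-shortest : Backward walk → IsShortest C p → len ≤ n / 2
    backward-shortest bwd (_ , minimal) =
      arc-bound (proj₁ (backward-vertices (lap (toℕ v)) (lap-orbit (toℕ v)) bwd (toℕ-mod-id v)))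
        (minimal≤backward minimal) (minimal≤forward minimal)

  -- A shorter competitor is monotone. If forward, it would reach the endpoint of the arc at two
  -- distinct times below `n`. If backward, it would close up with the arc into a circuit of
  -- positive length below `n`.
  forwardPath-minimal : ∀ s {ℓ} → ℓ ≤ n / 2 → Minimal (lap s 0) (lap s ℓ) ℓ
  forwardPath-minimal s {ℓ} ℓ≤n/2 q with monotone (Path.walk q) (Path.simple q) | ℓ ≤? Path.length q
  ... | _ | yes ℓ≤len = ℓ≤len
  ... | inj₁ fwd | no ℓ≰len =
    contradiction
      (lap-injective s {Path.length q} {ℓ} (<-trans len<ℓ ℓ<n) ℓ<n
        (proj₁ (forward-vertices (lap s) (lap-orbit s) fwd refl)))
      (<⇒≢ len<ℓ)
    where
    len<ℓ = ≰⇒> ℓ≰len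
    ℓ<n = ≤-<-trans ℓ≤n/2 (m/n<m n 2 (s≤s (s≤s z≤n)))
  ... | inj₂ bwd | no ℓ≰len =
    contradiction
      (trans (sym (lap-injective s {len + ℓ} {0} len+ℓ<n (>-nonZero⁻¹ n) returns)) (+-comm len ℓ))
      (<⇒≢ (≤-trans (≤-<-trans z≤n len<ℓ) (m≤m+n ℓ len)))
    where
    len = Path.length q
    len<ℓ = ≰⇒> ℓ≰len
    len+ℓ<n = <-≤-trans (+-monoˡ-< ℓ len<ℓ) (n≤m/2⇒n+n≤m ℓ≤n/2)
    -- The reversed competitor runs forward from `lap s ℓ`, which is index 0 of the orbit
    -- `lap (ℓ + s)`.
    returns : lap {n} s (len + ℓ) ≡ lap s 0
    returns = trans (mod-cong (len + ℓ + s) (len + (ℓ + s)) (cong (_% n) (+-assoc len ℓ s)))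
      (proj₁ (backward-vertices (lap (ℓ + s)) (lap-orbit (ℓ + s)) bwd refl))

  -- Independence and window counts

  module _ (d k-1 : ℕ) (S : Subset n) where

    private
      δ : ℕ
      δ = d ⊓ (n / 2)

    -- A shortest path of length at most `d` is an arc with at most `δ` edges, so its vertices fit
    -- in a window of `suc δ`. The rise of `H` over the arc bounds the count from above and is
    -- itself at most the rise over the window. `H` lives on natural numbers because it grows with
    -- every turn around the cycle.
    window-potential⇒independent : (H : ℕ → ℕ) →
      (∀ t → H t + χ S (t mod n) ≤ H (suc t)) →
      (∀ t → H (suc δ + t) ≤ k-1 + H t) →
      Independent C (suc k-1) d S
    window-potential⇒independent H H-step H-window {u} {v} p shortest len≤d = cases
      where
      open ≤-Reasoning

      H-mono : ∀ i {t} → H t ≤ H (i + t)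
      H-mono zero    = ≤-refl
      H-mono (suc i) = ≤-trans (H-mono i) (≤-trans (m≤m+n _ _) (H-step _))

      bound : ∀ s {c} → Path.length p ≤ n / 2 → H s + c ≤ H (suc (Path.length p) + s) → c < suc k-1
      bound s {c} len≤n/2 H+c≤H = s≤s (+-cancelˡ-≤ (H s) c k-1 (begin
        H s + c                                        ≤⟨ H+c≤H ⟩
        -- Pads the arc to a full window; `H` can only grow.
        H (suc ℓ + s)                                  ≤⟨ H-mono (δ ∸ ℓ) ⟩
        H (δ ∸ ℓ + (suc ℓ + s))                        ≡⟨ cong H (trans (+-suc (δ ∸ ℓ) (ℓ + s))
                                                            (cong suc (trans (sym (+-assoc (δ ∸ ℓ) ℓ s)) (cong (_+ s) (m∸n+n≡m (⊓-glb len≤d len≤n/2)))))) ⟩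
        H (suc δ + s)                                  ≤⟨ H-window s ⟩
        k-1 + H s                                      ≡⟨ +-comm k-1 (H s) ⟩
        H s + k-1                                      ∎))
        where ℓ = Path.length p

      cases : count S (Path.vertices p) < suc k-1
      cases with monotone (Path.walk p) (Path.simple p)
      ... | inj₁ fwd =
        subst (λ xs → count S xs < suc k-1)
          (sym (proj₂ (forward-vertices (lap (toℕ u)) (lap-orbit (toℕ u)) fwd (toℕ-mod-id u))))
          (bound (toℕ u) (forward-shortest p fwd shortest)
            (count-telescope-up S (lap (toℕ u)) (λ i → H (i + toℕ u)) (λ i → H-step (i + toℕ u)) _))
      ... | inj₂ bwd =
        subst (λ xs → count S xs < suc k-1)
          (sym (proj₂ (backward-vertices (lap (toℕ v)) (lap-orbit (toℕ v)) bwd (toℕ-mod-id v))))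
          (bound (toℕ v) (backward-shortest p bwd shortest)
            (count-telescope-down S (lap (toℕ v)) (λ i → H (i + toℕ v)) (λ i → H-step (i + toℕ v)) _))

    -- Double counting over a start `s` and an offset `i`: a fixed offset sees a rotated copy of the
    -- cycle and contributes the size of `S`, while a fixed start sees one window and contributes at
    -- most `k-1`.
    sum-χ-bound : Independent C (suc k-1) d S → sum (χ S) * suc δ ≤ k-1 * n
    sum-χ-bound indep = begin
      sum (χ S) * suc δ                                                      ≡⟨ *-comm (sum (χ S)) (suc δ) ⟩
      suc δ * sum (χ S)                                                      ≤⟨ sum-lower {suc δ} _ (λ i → ≤-reflexive (column i)) ⟩
      sum {suc δ} (λ i → sum {n} (λ s → χ S (lap (toℕ s) (toℕ i))))          ≡⟨ ∑-comm {suc δ} {n} (λ i s → χ S (lap (toℕ s) (toℕ i))) ⟩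
      sum {n} (λ s → sum {suc δ} (λ i → χ S (lap (toℕ s) (toℕ i))))          ≤⟨ sum-upper {n} _ (λ s → window (toℕ s)) ⟩
      n * k-1                                                                ≡⟨ *-comm n k-1 ⟩
      k-1 * n                                                                ∎
      where
      open ≤-Reasoning
      column : ∀ (i : Fin (suc δ)) → sum (χ S) ≡ sum {n} (λ s → χ S (lap (toℕ s) (toℕ i)))
      column i = sym (trans
        (sum-periodic n (λ t → χ S (t mod n)) (λ t → cong (χ S) ([n+t]mod t)) (toℕ i))
        (sum-cong-≗ {n} (λ s → cong (χ S) (toℕ-mod-id s))))

      window : ∀ s → sum {suc δ} (λ i → χ S (lap s (toℕ i))) ≤ k-1
      window s = s≤s⁻¹ (subst (_< suc k-1)
        (trans (cong (count S) (forwardWalk-vertices (lap s) (lap-orbit s) δ)) (count-applyUpTo S (lap s) (suc δ)))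
        -- The window is the vertex list of a forward arc with `δ` edges: `δ ≤ n / 2` makes the arc
        -- shortest and `δ ≤ d` brings it within the range of independence.
        (indep path ((path , refl) , λ q → ≤-trans (≤-reflexive len≡δ) (forwardPath-minimal s (m⊓n≤n d (n / 2)) q))
          (≤-trans (≤-reflexive len≡δ) (m⊓n≤m d (n / 2)))))
        where
        path = forwardPath s (≤-<-trans (m⊓n≤n d (n / 2)) (m/n<m n 2 (s≤s (s≤s z≤n))))
        len≡δ = forwardWalk-length (lap s) (lap-orbit s) δ

    sum-χ≤m : Independent C (suc k-1) d S → sum (χ S) ≤ k-1 * n / suc δ
    sum-χ≤m indep = m*n≤o⇒m≤o/n (sum (χ S)) (suc δ) (sum-χ-bound indep)

  -- Lower bound on the number of colors

  module _ (d k-1 : ℕ) where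

    private
      m : ℕ
      m = k-1 * n / suc (d ⊓ (n / 2))

    -- Every vertex lies in the class of its own color, so the class sizes add up to at least `n`.
    colorable⇒n≤c*m : ∀ {c} → Colorable C (suc k-1) d c → n ≤ c * m
    colorable⇒n≤c*m {c} (f , proper) = begin
      n                                                      ≡⟨ *-identityʳ n ⟨
      n * 1                                                  ≤⟨ sum-lower {n} _ covered ⟩
      sum {n} (λ v → sum {c} (λ j → χ (colorClass C f j) v)) ≡⟨ ∑-comm {n} {c} (λ v j → χ (colorClass C f j) v) ⟩
      sum {c} (λ j → sum (χ (colorClass C f j)))             ≤⟨ sum-upper {c} _ (λ j → sum-χ≤m d k-1 (colorClass C f j) (proper j)) ⟩
      c * m                                                  ∎
      where
      open ≤-Reasoning
      covered : ∀ v → 1 ≤ sum {c} (λ j → χ (colorClass C f j) v)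
      covered v = subst (_≤ sum {c} (λ j → χ (colorClass C f j) v))
        (χ-∈ (∈-colorClass⁺ {G = C} f v)) (term≤sum _ (f v))

    -- The rotation coloring

    module _ .{{_ : NonZero m}} where

      -- With `suc t` the color describes where the move from `t * m` to `suc t * m` lands, so that
      -- a color marks an entry into an interval.
      rotationColor : ℕ → ℕ
      rotationColor t = suc t * m % n / m

      rotationColoring : Fin n → Fin ⌈ n / m ⌉
      rotationColoring v = fromℕ< (r<m⇒r/n<⌈m/n⌉ n m (m%n<n (suc (toℕ v) * m) n))

      -- Replacing `t` by `t % n` changes `suc t * m` by a multiple of `n`, so the color at time `t`
      -- depends only on the vertex.
      toℕ-rotationColoring : ∀ t → toℕ (rotationColoring (t mod n)) ≡ rotationColor t
      toℕ-rotationColoring t = trans (toℕ-fromℕ< _) (cong (_/ m) (begin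
        suc (toℕ (t mod n)) * m % n                ≡⟨ cong (λ x → suc x * m % n) (toℕ-mod {n} t) ⟩
        suc (t % n) * m % n                        ≡⟨ [m+kn]%n≡m%n (suc (t % n) * m) (t / n * m) n ⟨
        (suc (t % n) * m + t / n * m * n) % n      ≡⟨ cong (_% n) (regroup (t % n) (t / n) m n) ⟩
        suc (t % n + t / n * n) * m % n            ≡⟨ cong (λ x → suc x * m % n) (m≡m%n+[m/n]*n t n) ⟨
        suc t * m % n                              ∎))
        where
        open ≡-Reasoning
        open +-*-Solver
        regroup : ∀ r q m n → suc r * m + q * m * n ≡ suc (r + q * n) * m
        regroup = solve 4 (λ r q m n →
          (con 1 :+ r) :* m :+ q :* m :* n := (con 1 :+ (r :+ q :* n)) :* m) refl

      -- For `j * m ≤ n` this is the number of points `j * m + i * n` with `i ≥ 0` that are at most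
      -- `t * m`. Adding `n` before subtracting `j * m` keeps the numerator natural and corrects the
      -- count by one.
      laps : ℕ → ℕ → ℕ
      laps j t = (t * m + (n ∸ j * m)) / n

      -- The interval of the color starts at `a`, and the landing residue `r` satisfies
      -- `a ≤ r < m + a`. The landing point `r + q * n` is thus at or past `a + q * n`, while the
      -- point `m` earlier is strictly before it: the move crosses a counted point.
      laps-entry : ∀ t → suc (laps (rotationColor t) t) ≤ laps (rotationColor t) (suc t)
      laps-entry t = ≤-trans (m<n*o⇒m/o<n {n = suc q} before) (m*n≤o⇒m≤o/n (suc q) n after)
        where
        open ≤-Reasoning
        r = suc t * m % n
        q = suc t * m / n
        a = r / m * m
        position : suc t * m ≡ r + q * n
        position = m≡m%n+[m/n]*n (suc t * m) n
        a≤r : a ≤ r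
        a≤r = m/n*n≤m r m
        n≡a+[n∸a] : a + (n ∸ a) ≡ n
        n≡a+[n∸a] = m+[n∸m]≡n (≤-trans a≤r (<⇒≤ (m%n<n (suc t * m) n)))
        r<m+a : r < m + a
        r<m+a = begin-strict
          r              ≡⟨ m≡m%n+[m/n]*n r m ⟩
          r % m + a      <⟨ +-monoˡ-< a (m%n<n r m) ⟩
          m + a          ∎
        after : suc q * n ≤ suc t * m + (n ∸ a)
        after = begin
          n + q * n                  ≡⟨ cong (_+ q * n) n≡a+[n∸a] ⟨
          a + (n ∸ a) + q * n        ≤⟨ +-monoˡ-≤ (q * n) (+-monoˡ-≤ (n ∸ a) a≤r) ⟩
          r + (n ∸ a) + q * n        ≡⟨ swap-right r (n ∸ a) (q * n) ⟩
          r + q * n + (n ∸ a)        ≡⟨ cong (_+ (n ∸ a)) position ⟨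
          suc t * m + (n ∸ a)        ∎
          where
          open +-*-Solver
          swap-right : ∀ x y z → x + y + z ≡ x + z + y
          swap-right = solve 3 (λ x y z → x :+ y :+ z := x :+ z :+ y) refl
        before : t * m + (n ∸ a) < suc q * n
        -- Adding `m` to both sides replaces the earlier position by `suc t * m` and avoids the
        -- difference of `r` and `m`.
        before = +-cancelˡ-< m _ _ (begin-strict
          m + (t * m + (n ∸ a))      ≡⟨ +-assoc m (t * m) (n ∸ a) ⟨
          suc t * m + (n ∸ a)        ≡⟨ cong (_+ (n ∸ a)) position ⟩
          r + q * n + (n ∸ a)        <⟨ +-monoˡ-< (n ∸ a) (+-monoˡ-< (q * n) r<m+a) ⟩
          m + a + q * n + (n ∸ a)    ≡⟨ regroup m a (q * n) (n ∸ a) ⟩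
          m + (a + (n ∸ a) + q * n)  ≡⟨ cong (λ x → m + (x + q * n)) n≡a+[n∸a] ⟩
          m + suc q * n              ∎)
          where
          open +-*-Solver
          regroup : ∀ m a x b → m + a + x + b ≡ m + (a + b + x)
          regroup = solve 4 (λ m a x b → m :+ a :+ x :+ b := m :+ (a :+ b :+ x)) refl

      laps-mono : ∀ j t → laps j t ≤ laps j (suc t)
      laps-mono j t = /-monoˡ-≤ n (+-monoˡ-≤ (n ∸ j * m) (m≤n+m (t * m) m))

      laps-step : ∀ j t →
        laps (toℕ j) t + χ (colorClass C rotationColoring j) (t mod n) ≤ laps (toℕ j) (suc t)
      laps-step j t with t mod n ∈? colorClass C rotationColoring j
      ... | no _ = ≤-trans (≤-reflexive (+-identityʳ _)) (laps-mono (toℕ j) t)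
      ... | yes t∈j
        -- Membership turns `toℕ j` into `rotationColor t`, so the move at time `t` is an entry into
        -- interval `j`.
        rewrite trans (sym (cong toℕ (∈-colorClass⁻ {G = C} rotationColoring t∈j))) (toℕ-rotationColoring t) =
        ≤-trans (≤-reflexive (+-comm _ 1)) (laps-entry t)

      laps-window : ∀ j t → laps j (suc (d ⊓ (n / 2)) + t) ≤ k-1 + laps j t
      laps-window j t = begin
        ((W + t) * m + b) / n            ≡⟨ cong (_/ n) (trans (cong (_+ b) (*-distribʳ-+ m W t)) (+-assoc (W * m) (t * m) b)) ⟩
        (W * m + (t * m + b)) / n        ≤⟨ /-monoˡ-≤ n (+-monoˡ-≤ (t * m + b) W*m≤[k-1]*n) ⟩
        (k-1 * n + (t * m + b)) / n      ≡⟨ [m*n+o]/n≡m+o/n k-1 n (t * m + b) ⟩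
        k-1 + laps j t                   ∎
        where
        open ≤-Reasoning
        W = suc (d ⊓ (n / 2))
        b = n ∸ j * m
        W*m≤[k-1]*n : W * m ≤ k-1 * n
        W*m≤[k-1]*n = ≤-trans (≤-reflexive (*-comm W m)) (m/n*n≤m (k-1 * n) W)

      rotationColoring-proper : Proper C (suc k-1) d rotationColoring
      rotationColoring-proper j = window-potential⇒independent d k-1
        (colorClass C rotationColoring j) (laps (toℕ j)) (laps-step j) (laps-window (toℕ j))

      cycle-chromaticNumber : IsChromaticNumber C (suc k-1) d ⌈ n / m ⌉
      cycle-chromaticNumber =
        -- Positivity comes from the residue 0, whose interval index lies below the ceiling.
        ≤-<-trans z≤n (r<m⇒r/n<⌈m/n⌉ n m (>-nonZero⁻¹ n)) ,
        (rotationColoring , rotationColoring-proper) ,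
        λ c _ colorable → m≤o*n⇒⌈m/n⌉≤o n m c (colorable⇒n≤c*m colorable)

-- Short paths in an arbitrary graph

length-walkVertices : ∀ {n} (G : Graph n) {u v} (p : Walk G u v) →
  length (walkVertices G p) ≡ suc (walkLength G p)
length-walkVertices G stop       = refl
length-walkVertices G (step _ p) = cong suc (length-walkVertices G p)

-- A path with at most `d` edges has at most `suc d` vertices in total, fewer than `k`, so one color
-- is enough.
short-paths⇒chromaticNumber≡1 : ∀ {n} (G : Graph n) d k → suc d < k → IsChromaticNumber G k d 1
short-paths⇒chromaticNumber≡1 G d k 1+d<k =
  ≤-refl , ((λ _ → zero) , proper) , λ _ 1≤c _ → 1≤c
  where
  open ≤-Reasoning
  proper : Proper G k d (λ _ → zero)
  proper i p _ len≤d = begin-strict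
    count (colorClass G (λ _ → zero) i) (Path.vertices p)  ≤⟨ length-filter (_∈? _) (Path.vertices p) ⟩
    length (Path.vertices p)                               ≡⟨ length-walkVertices G (Path.walk p) ⟩
    suc (Path.length p)                                    ≤⟨ s≤s len≤d ⟩
    suc d                                                  <⟨ 1+d<k ⟩
    k                                                      ∎

theorem5p7 : (d k n : ℕ) → 1 ≤ d → (k≥2 : 2 ≤ k) → (n≥3 : 3 ≤ n) →
    let δ = d ⊓ (n / 2)
        m = ((k ∸ 1) * n) / suc δ
    in (d ≤ k ∸ 2 → IsChromaticNumber (cycle n n≥3) k d 1)
     × (k ∸ 1 ≤ d → IsChromaticNumber (cycle n n≥3) k d (⌈ n / m ⌉ {{m-nonZero d k n k≥2 n≥3}}))
theorem5p7 d k@(suc (suc _)) n _ k≥2@(s≤s (s≤s _)) n≥3 =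
  -- Matching `k` as a double successor makes `k ∸ 2` compute; the two `s≤s` then give `suc d < k`.
  (λ d≤k-2 → short-paths⇒chromaticNumber≡1 (cycle n n≥3) d k (s≤s (s≤s d≤k-2))) ,
  (λ _ → cycle-chromaticNumber n≥3 d (k ∸ 1) {{m-nonZero d k n k≥2 n≥3}})
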